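{- Let $0 \le p \le 1$ and let $n$ be even. Inserting the converging sequence $1, n, 2, n-1, 3, n-2, \ldots, n/2, n/2+1$ into an initially empty binary search tree, applying \textsc{RebalanceZig} after each insertion, results in a binary search tree whose expected average node depth is $\Theta(n)$.
   Context: Each new element is first placed as a new leaf $v$ at its standard unbalanced BST position, and then \textsc{RebalanceZig}$(v)$ is applied: while $v$ has a parent and an independent coin flip shows tail (tail has probability $p$, head probability $1-p$), set $v\gets$ parent of $v$; afterwards, if $v$ has a parent, rotate $v$ up (the standard single rotation at the parent of $v$ that moves $v$ one level up). The depth of a node is the number of edges from it to the root; the average node depth is the sum of depths of all $n$ nodes divided by $n$. Expectation is over the coin flips.
   Formalization: The tail probability p ranges over the rational numbers in [0,1] instead of the real numbers; the constants in Θ(n) may depend on p. -}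

module Defs where

open import Data.Nat as ℕ using (ℕ; zero; suc; _+_; _∸_; _<ᵇ_; _≡ᵇ_)
open import Data.Nat.DivMod using (_/_)
open import Data.Bool using (Bool; true; false; if_then_else_)
open import Data.List using (List; []; _∷_; _++_; reverse; concatMap; foldl)
open import Data.Product using (_×_; _,_)
open import Data.Integer using (+_)
open import Data.Rational as ℚ using (ℚ; 0ℚ; 1ℚ; _*_; _-_)
import Data.Rational as Q

data Tree : Set where
  leaf : Tree
  node : Tree → ℕ → Tree → Tree

data Dir : Set where
  L R : Dir

insert : ℕ → Tree → Tree × List Dir
insert x leaf = node leaf x leaf , []
insert x (node l y r) with x <ᵇ y | y <ᵇ x
... | true | _ with insert x l
...   | l' , π = node l' y r , L ∷ π
insert x (node l y r) | false | true with insert x r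
...   | r' , π = node l y r' , R ∷ π
insert x (node l y r) | false | false = node l y r , []  -- duplicate key (never happens here)

rotateChild : Dir → Tree → Tree
rotateChild L (node (node a x b) y c) = node a x (node b y c)
rotateChild R (node a x (node b y c)) = node (node a x b) y c
rotateChild _ t = t

applyAt : List Dir → (Tree → Tree) → Tree → Tree
applyAt [] f t = f t
applyAt (L ∷ π) f (node l x r) = node (applyAt π f l) x r
applyAt (R ∷ π) f (node l x r) = node l x (applyAt π f r)
applyAt (_ ∷ _) f leaf = leaf

Dist : Set
Dist = List (ℚ × Tree)

-- RebalanceZig with tail probability p.  The argument 'rev' is the path
-- from the root to the current node v, reversed (last step first).
-- If v has a parent (rev = d ∷ rest): with probability 1-p (head) stop and
-- rotate v up (rotation at the parent, whose path is reverse rest);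
-- with probability p (tail) move v to its parent and continue.
-- If v is the root (rev = []): stop without rotating.
rebalanceZig : ℚ → List Dir → ℚ → Tree → Dist
rebalanceZig p [] w t = (w , t) ∷ []
rebalanceZig p (d ∷ rest) w t =
  (w * (1ℚ - p) , applyAt (reverse rest) (rotateChild d) t)
  ∷ rebalanceZig p rest (w * p) t

insertZig : ℚ → ℕ → ℚ → Tree → Dist
insertZig p x w t with insert x t
... | t' , π = rebalanceZig p (reverse π) w t'

stepDist : ℚ → Dist → ℕ → Dist
stepDist p D x = concatMap (λ { (w , t) → insertZig p x w t }) D

runZig : ℚ → List ℕ → Dist
runZig p xs = foldl (stepDist p) ((1ℚ , leaf) ∷ []) xs

depthSum : ℕ → Tree → ℕ
depthSum d leaf = 0
depthSum d (node l _ r) = d + depthSum (suc d) l + depthSum (suc d) r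

convSeqFrom : ℕ → ℕ → ℕ → List ℕ
convSeqFrom n i zero = []
convSeqFrom n i (suc k) = i ∷ (suc n ∸ i) ∷ convSeqFrom n (suc i) k

convSeq : ℕ → List ℕ
convSeq n = convSeqFrom n 1 (n / 2)

expAvgDepth : ℕ → Dist → ℚ
expAvgDepth zero D = 0ℚ
expAvgDepth (suc k) [] = 0ℚ
expAvgDepth (suc k) ((w , t) ∷ D) =
  w * ((+ depthSum 0 t) Q./ suc k) Q.+ expAvgDepth (suc k) D

E : ℚ → ℕ → ℚ
E p n = expAvgDepth n (runZig p (convSeq n))

ℕtoℚ : ℕ → ℚ
ℕtoℚ n = (+ n) Q./ 1

{-# OPTIONS --safe #-}
-- All keys still to be inserted lie in one gap of the tree, so the tree is
-- governed by the path w ∈ {L,R}* leading to that gap. Inserting a small (large)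
-- key appends R (L) to w; a rotation then exchanges two adjacent distinct letters
-- or deletes one of two adjacent equal letters, and in all cases the nodes on w
-- contribute |w|(|w| - 1)/2 to the depth sum. So it is enough that E|w| grows
-- linearly. If w ends differently from the new letter, then with probability
-- 1 - p the coin shows head at once and the last two letters are exchanged
-- without loss; if it ends like the new letter, at most one letter is lost and
-- the path again ends differently from the following letter, since the letters
-- alternate. Hence for p < 1 the potential |w| - g[w ends like the next letter]
-- with g = (1 - p)/2 increases by g per insertion in expectation; for p = 1 no
-- rotation ever takes place. Convexity of m ↦ m² (as a tangent inequality) turns
-- this into a quadratic bound on the expected depth sum.

module Submission where

open import Defs
open import Data.Bool using (Bool; true; false)
open import Data.Integer as ℤ using (+_)
import Data.Integer.Properties as ℤ
open import Data.List using (List; []; _∷_; _++_; [_]; _ʳ++_; reverse; foldl; last; length)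
open import Data.List.Properties using (ʳ++-defn; length-ʳ++; length-reverse; reverse-involutive)
open import Data.Maybe using (Maybe; just; nothing)
open import Data.Nat using (ℕ; zero; suc; _≤_)
import Data.Nat as ℕ
open import Data.Nat.Divisibility using (_∣_; divides)
open import Data.Nat.DivMod using (m*n/n≡m)
import Data.Nat.Properties as ℕ
import Data.Nat.Solver as ℕ
open import Data.Product using (Σ; _×_; _,_; proj₁; proj₂)
open import Data.Rational using (ℚ; 0ℚ; 1ℚ; ½; _*_; _<_; _+_; _-_; -_; mkℚ; fromℚᵘ; toℚᵘ; positive; nonNegative; *<*) renaming (_≤_ to _≤ℚ_)
import Data.Rational as ℚ
open import Data.Rational.Properties as ℚ using (module ≤-Reasoning)
open import Data.Rational.Solver using (module +-*-Solver)
open import Data.Rational.Unnormalised as ℚᵘ using (mkℚᵘ; *≡*)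
import Data.Rational.Unnormalised.Properties as ℚᵘ
open import Data.Sum using (inj₁; inj₂)
open import Data.Unit using (tt)
open import Relation.Nullary using (yes; no)
open import Relation.Nullary.Negation using (contradiction)
open import Relation.Binary.PropositionalEquality using (_≡_; refl; sym; trans; cong; cong₂; subst; module ≡-Reasoning)

-- Rational arithmetic

*-nonNeg : ∀ {x y} → 0ℚ ≤ℚ x → 0ℚ ≤ℚ y → 0ℚ ≤ℚ x * y
*-nonNeg {x} {y} 0≤x 0≤y = ℚ.nonNegative⁻¹ (x * y) {{ℚ.nonNeg*nonNeg⇒nonNeg x {{nonNegative 0≤x}} y {{nonNegative 0≤y}}}}

+-nonNeg : ∀ {x y} → 0ℚ ≤ℚ x → 0ℚ ≤ℚ y → 0ℚ ≤ℚ x + y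
+-nonNeg = ℚ.+-mono-≤

square-nonNeg : ∀ x → 0ℚ ≤ℚ x * x
square-nonNeg x with ℚ.≤-total 0ℚ x
... | inj₁ 0≤x = *-nonNeg 0≤x 0≤x
... | inj₂ x≤0 = subst (0ℚ ≤ℚ_) (+-*-Solver.solve 1 (λ x → (:- x) :* (:- x) := x :* x) refl x)
                   (*-nonNeg (ℚ.neg-antimono-≤ x≤0) (ℚ.neg-antimono-≤ x≤0))
  where open +-*-Solver

≤-fromDifference : ∀ {x y} z → 0ℚ ≤ℚ z → y ≡ x + z → x ≤ℚ y
≤-fromDifference {x} {y} z 0≤z y≡x+z = begin
  x       ≡⟨ ℚ.+-identityʳ x ⟨
  x + 0ℚ  ≤⟨ ℚ.+-monoʳ-≤ x 0≤z ⟩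
  x + z   ≡⟨ y≡x+z ⟨
  y       ∎
  where open ≤-Reasoning

difference-nonNeg : ∀ {x y} → x ≤ℚ y → 0ℚ ≤ℚ y - x
difference-nonNeg {x} {y} x≤y = begin
  0ℚ     ≡⟨ ℚ.+-inverseʳ x ⟨
  x - x  ≤⟨ ℚ.+-monoˡ-≤ (- x) x≤y ⟩
  y - x  ∎
  where open ≤-Reasoning

neg-cancel-≤ : ∀ {x y} → - y ≤ℚ - x → x ≤ℚ y
neg-cancel-≤ {x} {y} -y≤-x = ≤-fromDifference (- x - - y) (difference-nonNeg -y≤-x)
  (solve 2 (λ x y → y := x :+ (:- x :- (:- y))) refl x y)
  where open +-*-Solver

*-monoˡ-≤ : ∀ {w x y} → 0ℚ ≤ℚ w → x ≤ℚ y → w * x ≤ℚ w * y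
*-monoˡ-≤ {w} 0≤w = ℚ.*-monoˡ-≤-nonNeg w {{nonNegative 0≤w}}

*-monoʳ-≤ : ∀ {w x y} → 0ℚ ≤ℚ w → x ≤ℚ y → x * w ≤ℚ y * w
*-monoʳ-≤ {w} 0≤w = ℚ.*-monoʳ-≤-nonNeg w {{nonNegative 0≤w}}

fromℚᵘ-homo-+ : ∀ x y → fromℚᵘ (x ℚᵘ.+ y) ≡ fromℚᵘ x + fromℚᵘ y
fromℚᵘ-homo-+ x y = ℚ.toℚᵘ-injective (begin
  toℚᵘ (fromℚᵘ (x ℚᵘ.+ y))               ≈⟨ ℚ.toℚᵘ-fromℚᵘ (x ℚᵘ.+ y) ⟩
  x ℚᵘ.+ y                               ≈⟨ ℚᵘ.+-cong (ℚ.toℚᵘ-fromℚᵘ x) (ℚ.toℚᵘ-fromℚᵘ y) ⟨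
  toℚᵘ (fromℚᵘ x) ℚᵘ.+ toℚᵘ (fromℚᵘ y)   ≈⟨ ℚ.toℚᵘ-homo-+ (fromℚᵘ x) (fromℚᵘ y) ⟨
  toℚᵘ (fromℚᵘ x + fromℚᵘ y)             ∎)
  where open ℚᵘ.≃-Reasoning

fromℚᵘ-homo-* : ∀ x y → fromℚᵘ (x ℚᵘ.* y) ≡ fromℚᵘ x * fromℚᵘ y
fromℚᵘ-homo-* x y = ℚ.toℚᵘ-injective (begin
  toℚᵘ (fromℚᵘ (x ℚᵘ.* y))               ≈⟨ ℚ.toℚᵘ-fromℚᵘ (x ℚᵘ.* y) ⟩
  x ℚᵘ.* y                               ≈⟨ ℚᵘ.*-cong (ℚ.toℚᵘ-fromℚᵘ x) (ℚ.toℚᵘ-fromℚᵘ y) ⟨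
  toℚᵘ (fromℚᵘ x) ℚᵘ.* toℚᵘ (fromℚᵘ y)   ≈⟨ ℚ.toℚᵘ-homo-* (fromℚᵘ x) (fromℚᵘ y) ⟨
  toℚᵘ (fromℚᵘ x * fromℚᵘ y)             ∎)
  where open ℚᵘ.≃-Reasoning

ℕtoℚ-homo-+ : ∀ m n → ℕtoℚ (m ℕ.+ n) ≡ ℕtoℚ m + ℕtoℚ n
ℕtoℚ-homo-+ m n = trans
  (ℚ.fromℚᵘ-cong {mkℚᵘ (+ (m ℕ.+ n)) 0} {mkℚᵘ (+ m) 0 ℚᵘ.+ mkℚᵘ (+ n) 0}
    (*≡* (cong (ℤ._* + 1) (sym (cong₂ ℤ._+_ (ℤ.*-identityʳ (+ m)) (ℤ.*-identityʳ (+ n)))))))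
  (fromℚᵘ-homo-+ (mkℚᵘ (+ m) 0) (mkℚᵘ (+ n) 0))

ℕtoℚ-homo-* : ∀ m n → ℕtoℚ (m ℕ.* n) ≡ ℕtoℚ m * ℕtoℚ n
ℕtoℚ-homo-* m n = trans
  (ℚ.fromℚᵘ-cong {mkℚᵘ (+ (m ℕ.* n)) 0} {mkℚᵘ (+ m) 0 ℚᵘ.* mkℚᵘ (+ n) 0}
    (*≡* (cong (ℤ._* + 1) (ℤ.pos-* m n))))
  (fromℚᵘ-homo-* (mkℚᵘ (+ m) 0) (mkℚᵘ (+ n) 0))

ℕtoℚ-nonNeg : ∀ n → 0ℚ ≤ℚ ℕtoℚ n
ℕtoℚ-nonNeg n = ℚ.nonNegative⁻¹ (ℕtoℚ n) {{ℚ.normalize-nonNeg n 1}}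

ℕtoℚ-mono : ∀ {m n} → m ≤ n → ℕtoℚ m ≤ℚ ℕtoℚ n
ℕtoℚ-mono {m} {n} m≤n = ≤-fromDifference (ℕtoℚ (n ℕ.∸ m)) (ℕtoℚ-nonNeg (n ℕ.∸ m))
  (trans (cong ℕtoℚ (sym (ℕ.m+[n∸m]≡n m≤n))) (ℕtoℚ-homo-+ m (n ℕ.∸ m)))

ℕtoℚ-suc : ∀ n → ℕtoℚ (suc n) ≡ 1ℚ + ℕtoℚ n
ℕtoℚ-suc = ℕtoℚ-homo-+ 1

n*[d/n]≡d : ∀ k d → ℕtoℚ (suc k) * ((+ d) ℚ./ suc k) ≡ ℕtoℚ d
n*[d/n]≡d k d = trans
  (sym (fromℚᵘ-homo-* (mkℚᵘ (+ suc k) 0) (mkℚᵘ (+ d) k)))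
  (ℚ.fromℚᵘ-cong {mkℚᵘ (+ suc k) 0 ℚᵘ.* mkℚᵘ (+ d) k} {mkℚᵘ (+ d) 0}
    (*≡* (trans (ℤ.*-identityʳ _) (trans (ℤ.*-comm (+ suc k) (+ d))
      (cong (λ m → + d ℤ.* + m) (sym (ℕ.+-identityʳ (suc k))))))))

-- The denominator of `g` serves, because a positive numerator is at least 1.
archimedean : ∀ g → 0ℚ < g → Σ ℕ λ N → (0 ℕ.< N) × (1ℚ ≤ℚ ℕtoℚ N * g)
archimedean (mkℚ (+ 0) d c) (*<* (ℤ.+<+ ()))
archimedean g@(mkℚ (+ suc m) d c) _ = suc d , ℕ.s≤s ℕ.z≤n ,
  (begin
    1ℚ                                       ≤⟨ ℕtoℚ-mono {1} {suc m} (ℕ.s≤s ℕ.z≤n) ⟩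
    ℕtoℚ (suc m)                             ≡⟨ n*[d/n]≡d d (suc m) ⟨
    ℕtoℚ (suc d) * ((+ suc m) ℚ./ suc d)     ≡⟨ cong (ℕtoℚ (suc d) *_) (ℚ.↥p/↧p≡p g) ⟩
    ℕtoℚ (suc d) * g                         ∎)
  where open ≤-Reasoning
archimedean (mkℚ ℤ.-[1+ m ] d c) (*<* ())

-- Expectations over weighted lists of trees

𝔼 : (Tree → ℚ) → Dist → ℚ
𝔼 f [] = 0ℚ
𝔼 f ((w , t) ∷ D) = w * f t + 𝔼 f D

-- Undoes the division by n in each summand of `expAvgDepth`. The factor `ρ` is -1 for the upper
-- bound and 4 for the lower one, so that both become lower bounds on some `𝔼 f`.
𝔼-depthSum : ∀ ρ k D →
  𝔼 (λ t → ρ * ℕtoℚ (depthSum 0 t)) D ≡ ρ * (ℕtoℚ (suc k) * expAvgDepth (suc k) D)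
𝔼-depthSum ρ k [] = sym (trans (cong (ρ *_) (ℚ.*-zeroʳ (ℕtoℚ (suc k)))) (ℚ.*-zeroʳ ρ))
𝔼-depthSum ρ k ((w , t) ∷ D) = begin
  w * (ρ * ℕtoℚ s) + 𝔼 (λ t → ρ * ℕtoℚ (depthSum 0 t)) D
    ≡⟨ cong₂ (λ x y → w * (ρ * x) + y) (sym (n*[d/n]≡d k s)) (𝔼-depthSum ρ k D) ⟩
  w * (ρ * (n * a)) + ρ * (n * e)
    ≡⟨ solve 5 (λ w ρ n a e → w :* (ρ :* (n :* a)) :+ ρ :* (n :* e) := ρ :* (n :* (w :* a :+ e))) refl w ρ n a e ⟩
  ρ * (n * (w * a + e)) ∎
  where
  open ≡-Reasoning
  open +-*-Solver
  s = depthSum 0 t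
  n = ℕtoℚ (suc k)
  a = (+ s) ℚ./ suc k
  e = expAvgDepth (suc k) D

-- `Lower P D v` certifies that v is at most the P-weighted total of D, where
-- `P t u` reads "the tree t is worth at least u".
data Lower (P : Tree → ℚ → Set) : Dist → ℚ → Set where
  nil  : ∀ {v} → v ≤ℚ 0ℚ → Lower P [] v
  cons : ∀ {w t D u v v′} → 0ℚ ≤ℚ w → P t u → v ≤ℚ w * u + v′ → Lower P D v′ →
         Lower P ((w , t) ∷ D) v

Lower-weaken : ∀ {P D v v′} → v′ ≤ℚ v → Lower P D v → Lower P D v′
Lower-weaken v′≤v (nil v≤0)          = nil (ℚ.≤-trans v′≤v v≤0)
Lower-weaken v′≤v (cons 0≤w Ptu v≤ ℓ) = cons 0≤w Ptu (ℚ.≤-trans v′≤v v≤) ℓ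

Lower-map : ∀ {P Q D v} → (∀ {t u} → P t u → Q t u) → Lower P D v → Lower Q D v
Lower-map P⇒Q (nil v≤0)           = nil v≤0
Lower-map P⇒Q (cons 0≤w Ptu v≤ ℓ) = cons 0≤w (P⇒Q Ptu) v≤ (Lower-map P⇒Q ℓ)

Lower-++ : ∀ {P D D′ v v′} → Lower P D v → Lower P D′ v′ → Lower P (D ++ D′) (v + v′)
Lower-++ {v′ = v′} (nil v≤0) ℓ′ = Lower-weaken
  (ℚ.≤-trans (ℚ.+-monoˡ-≤ v′ v≤0) (ℚ.≤-reflexive (ℚ.+-identityˡ v′))) ℓ′
Lower-++ {v′ = v′} (cons {w} {u = u} {v′ = v″} 0≤w Ptu v≤ ℓ) ℓ′ = cons 0≤w Ptu
  (ℚ.≤-trans (ℚ.+-monoˡ-≤ v′ v≤) (ℚ.≤-reflexive (ℚ.+-assoc (w * u) v″ v′))) (Lower-++ ℓ ℓ′)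

Lower-𝔼 : ∀ {P f D v} → (∀ {t u} → P t u → u ≤ℚ f t) → Lower P D v → v ≤ℚ 𝔼 f D
Lower-𝔼 P⇒≤ (nil v≤0) = v≤0
Lower-𝔼 P⇒≤ (cons 0≤w Ptu v≤ ℓ) =
  ℚ.≤-trans v≤ (ℚ.+-mono-≤ (*-monoˡ-≤ 0≤w (P⇒≤ Ptu)) (Lower-𝔼 P⇒≤ ℓ))

Lower-point : ∀ {P w t u} → 0ℚ ≤ℚ w → P t u → Lower P ((w , t) ∷ []) (w * u)
Lower-point 0≤w Ptu = cons 0≤w Ptu (ℚ.≤-reflexive (sym (ℚ.+-identityʳ _))) (nil ℚ.≤-refl)

Lower-step : ∀ {P Q p x D v} →
  (∀ {w t u} → 0ℚ ≤ℚ w → P t u → Lower Q (insertZig p x w t) (w * u)) →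
  Lower P D v → Lower Q (stepDist p D x) v
Lower-step step (nil v≤0) = nil v≤0
Lower-step step (cons 0≤w Ptu v≤ ℓ) = Lower-weaken v≤ (Lower-++ (step 0≤w Ptu) (Lower-step step ℓ))

-- The weights `w * (1ℚ - p)` and `w * p` of the two coin outcomes add up to `w`, so a worth `u`
-- common to both passes through.
Lower-branch : ∀ {P p d rest w t u} → p ≤ℚ 1ℚ → 0ℚ ≤ℚ w →
  P (applyAt (reverse rest) (rotateChild d) t) u →
  Lower P (rebalanceZig p rest (w * p) t) ((w * p) * u) →
  Lower P (rebalanceZig p (d ∷ rest) w t) (w * u)
Lower-branch {p = p} {w = w} {u = u} p≤1 0≤w Pu ℓ =
  cons (*-nonNeg 0≤w (difference-nonNeg p≤1)) Pu
    (ℚ.≤-reflexive (solve 3 (λ w p u → w :* u := (w :* (con 1ℚ :- p)) :* u :+ (w :* p) :* u) refl w p u)) ℓ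
  where open +-*-Solver

-- The upper bound

size : Tree → ℕ
size leaf         = 0
size (node l _ r) = suc (size l ℕ.+ size r)

size-insert : ∀ x t → size (proj₁ (insert x t)) ≤ suc (size t)
size-insert x leaf = ℕ.≤-refl
size-insert x (node l y r) with x ℕ.<ᵇ y | y ℕ.<ᵇ x
... | true  | _     = ℕ.s≤s (ℕ.+-monoˡ-≤ (size r) (size-insert x l))
... | false | true  = ℕ.s≤s (ℕ.≤-trans (ℕ.+-monoʳ-≤ (size l) (size-insert x r))
                                       (ℕ.≤-reflexive (ℕ.+-suc (size l) (size r))))
... | false | false = ℕ.n≤1+n _

size-rotateChild : ∀ d t → size (rotateChild d t) ≡ size t
size-rotateChild L leaf = refl
size-rotateChild L (node leaf y c) = refl
size-rotateChild L (node (node a x b) y c) = ℕ.+-*-Solver.solve 3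
  (λ a b c → con 1 :+ (a :+ (con 1 :+ (b :+ c))) := con 1 :+ ((con 1 :+ (a :+ b)) :+ c)) refl (size a) (size b) (size c)
  where open ℕ.+-*-Solver
size-rotateChild R leaf = refl
size-rotateChild R (node a x leaf) = refl
size-rotateChild R (node a x (node b y c)) = ℕ.+-*-Solver.solve 3
  (λ a b c → con 1 :+ ((con 1 :+ (a :+ b)) :+ c) := con 1 :+ (a :+ (con 1 :+ (b :+ c)))) refl (size a) (size b) (size c)
  where open ℕ.+-*-Solver

size-applyAt : ∀ π d t → size (applyAt π (rotateChild d) t) ≡ size t
size-applyAt []      d t            = size-rotateChild d t
size-applyAt (L ∷ π) d leaf         = refl
size-applyAt (R ∷ π) d leaf         = refl
size-applyAt (L ∷ π) d (node l x r) = cong (λ s → suc (s ℕ.+ size r)) (size-applyAt π d l)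
size-applyAt (R ∷ π) d (node l x r) = cong (λ s → suc (size l ℕ.+ s)) (size-applyAt π d r)

-- Every node of `t` lies at a depth below `d + size t`.
depthSum≤ : ∀ d t → depthSum d t ≤ size t ℕ.* (d ℕ.+ size t)
depthSum≤ d leaf = ℕ.z≤n
depthSum≤ d (node l x r) = begin
  d ℕ.+ depthSum (suc d) l ℕ.+ depthSum (suc d) r
    ≤⟨ ℕ.+-mono-≤ (ℕ.+-monoʳ-≤ d (depthSum≤ (suc d) l)) (depthSum≤ (suc d) r) ⟩
  d ℕ.+ a ℕ.* (suc d ℕ.+ a) ℕ.+ b ℕ.* (suc d ℕ.+ b)
    ≤⟨ ℕ.m≤m+n _ (1 ℕ.+ a ℕ.+ b ℕ.+ (a ℕ.* b ℕ.+ a ℕ.* b)) ⟩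
  d ℕ.+ a ℕ.* (suc d ℕ.+ a) ℕ.+ b ℕ.* (suc d ℕ.+ b) ℕ.+ (1 ℕ.+ a ℕ.+ b ℕ.+ (a ℕ.* b ℕ.+ a ℕ.* b))
    ≡⟨ ℕ.+-*-Solver.solve 3 (λ d a b →
         d :+ a :* (con 1 :+ d :+ a) :+ b :* (con 1 :+ d :+ b) :+ (con 1 :+ a :+ b :+ (a :* b :+ a :* b))
         := (con 1 :+ (a :+ b)) :* (d :+ (con 1 :+ (a :+ b)))) refl d a b ⟩
  suc (a ℕ.+ b) ℕ.* (d ℕ.+ suc (a ℕ.+ b)) ∎
  where
  open ℕ.≤-Reasoning
  open ℕ.+-*-Solver
  a = size l
  b = size r

-- The worth is one constant `c` for all trees. A bound from above on depth sums is a bound from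
-- below on their negatives, so `Lower` also yields the upper bound, with `c` equal to minus n².
SizeAtMost : ℚ → ℕ → Tree → ℚ → Set
SizeAtMost c m t u = (size t ≤ m) × (u ≡ c)

rebalanceZig-size : ∀ {p c m w t} → 0ℚ ≤ℚ p → p ≤ℚ 1ℚ → 0ℚ ≤ℚ w → size t ≤ m → ∀ rev →
  Lower (SizeAtMost c m) (rebalanceZig p rev w t) (w * c)
rebalanceZig-size 0≤p p≤1 0≤w s≤m [] = Lower-point 0≤w (s≤m , refl)
rebalanceZig-size 0≤p p≤1 0≤w s≤m (d ∷ rest) = Lower-branch {d = d} p≤1 0≤w
  (subst (_≤ _) (sym (size-applyAt (reverse rest) d _)) s≤m , refl)
  (rebalanceZig-size 0≤p p≤1 (*-nonNeg 0≤w 0≤p) s≤m rest)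

foldl-size : ∀ {p c} → 0ℚ ≤ℚ p → p ≤ℚ 1ℚ → ∀ xs {m D v} → Lower (SizeAtMost c m) D v →
  Lower (SizeAtMost c (m ℕ.+ length xs)) (foldl (stepDist p) D xs) v
foldl-size 0≤p p≤1 [] {m} ℓ rewrite ℕ.+-identityʳ m = ℓ
foldl-size 0≤p p≤1 (x ∷ xs) {m} ℓ rewrite ℕ.+-suc m (length xs) =
  foldl-size 0≤p p≤1 xs (Lower-step step ℓ)
  where
  step : ∀ {w t u} → 0ℚ ≤ℚ w → SizeAtMost _ m t u → Lower (SizeAtMost _ (suc m)) (insertZig _ x w t) (w * u)
  step {t = t} 0≤w (s≤m , refl) =
    rebalanceZig-size 0≤p p≤1 0≤w (ℕ.≤-trans (size-insert x t) (ℕ.s≤s s≤m)) (reverse (proj₂ (insert x t)))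

length-convSeqFrom : ∀ n i k → length (convSeqFrom n i k) ≡ k ℕ.+ k
length-convSeqFrom n i zero    = refl
length-convSeqFrom n i (suc k) = cong suc (trans (cong suc (length-convSeqFrom n (suc i) k)) (sym (ℕ.+-suc k k)))

avgDepth-upper : ∀ {p} → 0ℚ ≤ℚ p → p ≤ℚ 1ℚ → ∀ n {k} → suc n ≡ k ℕ.+ k →
  expAvgDepth (suc n) (runZig p (convSeqFrom (suc n) 1 k)) ≤ℚ ℕtoℚ (suc n)
avgDepth-upper {p} 0≤p p≤1 n {k} n≡2k = ℚ.*-cancelˡ-≤-pos N {{positive 0<N}}
  (neg-cancel-≤ bound)
  where
  N = ℕtoℚ (suc n)
  D = runZig p (convSeqFrom (suc n) 1 k)
  e = expAvgDepth (suc n) D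

  0<N : 0ℚ < N
  0<N = ℚ.<-≤-trans (ℚ.positive⁻¹ 1ℚ) (ℕtoℚ-mono {1} {suc n} (ℕ.s≤s ℕ.z≤n))

  worth : ∀ {t u} → SizeAtMost (- (N * N)) (length (convSeqFrom (suc n) 1 k)) t u →
    u ≤ℚ (- 1ℚ) * ℕtoℚ (depthSum 0 t)
  worth {t} (s≤m , refl) = begin
    - (N * N)                          ≡⟨ cong -_ (ℕtoℚ-homo-* (suc n) (suc n)) ⟨
    - ℕtoℚ (suc n ℕ.* suc n)           ≤⟨ ℚ.neg-antimono-≤ (ℕtoℚ-mono (ℕ.≤-trans (depthSum≤ 0 t) (ℕ.*-mono-≤ s≤n s≤n))) ⟩
    - ℕtoℚ (depthSum 0 t)              ≡⟨ solve 1 (λ x → :- x := (:- con 1ℚ) :* x) refl (ℕtoℚ (depthSum 0 t)) ⟩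
    (- 1ℚ) * ℕtoℚ (depthSum 0 t)       ∎
    where
    open ≤-Reasoning
    open +-*-Solver
    s≤n : size t ≤ suc n
    s≤n = ℕ.≤-trans s≤m (ℕ.≤-reflexive (trans (length-convSeqFrom (suc n) 1 k) (sym n≡2k)))

  bound : - (N * N) ≤ℚ - (N * e)
  bound = begin
    - (N * N)            ≡⟨ ℚ.*-identityˡ _ ⟨
    1ℚ * - (N * N)       ≤⟨ Lower-𝔼 worth (foldl-size 0≤p p≤1 (convSeqFrom (suc n) 1 k)
                              (Lower-point (ℚ.nonNegative⁻¹ 1ℚ) (ℕ.z≤n , refl))) ⟩
    𝔼 (λ t → (- 1ℚ) * ℕtoℚ (depthSum 0 t)) D
                         ≡⟨ 𝔼-depthSum (- 1ℚ) n D ⟩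
    (- 1ℚ) * (N * e)     ≡⟨ solve 1 (λ x → (:- con 1ℚ) :* x := :- x) refl (N * e) ⟩
    - (N * e)            ∎
    where
    open ≤-Reasoning
    open +-*-Solver

-- The search path of the gap

-- `Spine a b t w`: every key strictly between a and b is searched for along
-- the same root-to-leaf path w of t.
data Spine (a b : ℕ) : Tree → List Dir → Set where
  end   : Spine a b leaf []
  left  : ∀ {l y r w} → b ≤ y → Spine a b l w → Spine a b (node l y r) (L ∷ w)
  right : ∀ {l y r w} → y ≤ a → Spine a b r w → Spine a b (node l y r) (R ∷ w)

Bounds : Dir → ℕ → ℕ → ℕ → Set
Bounds L x a b = b ≤ x
Bounds R x a b = x ≤ a

singleton-Spine : ∀ {a b} e x → Bounds e x a b → Spine a b (node leaf x leaf) [ e ]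
singleton-Spine L x b≤x = left b≤x end
singleton-Spine R x x≤a = right x≤a end

<ᵇ-true : ∀ {m n} → m ℕ.< n → (m ℕ.<ᵇ n) ≡ true
<ᵇ-true {m} {n} m<n with m ℕ.<ᵇ n | ℕ.<⇒<ᵇ m<n
... | true | _ = refl

<ᵇ-false : ∀ {m n} → n ≤ m → (m ℕ.<ᵇ n) ≡ false
<ᵇ-false {m} {n} n≤m with m ℕ.<ᵇ n | ℕ.<ᵇ⇒< m n
... | false | _ = refl
... | true  | f = contradiction (f tt) (ℕ.≤⇒≯ n≤m)

-- The keys on the path lie outside the open gap, so each comparison turns out for `x` as for any
-- other key of the gap, and `x` lands at the end of the path. There it sends searches in the new
-- gap from `a′` to `b′` in direction `e`.
insert-Spine : ∀ {a b a′ b′ x t w} e → a ℕ.< x → x ℕ.< b → a ≤ a′ → b′ ≤ b → Bounds e x a′ b′ →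
  Spine a b t w → Σ Tree λ t′ → (insert x t ≡ (t′ , w)) × Spine a′ b′ t′ (w ++ [ e ])
insert-Spine {x = x} e a<x x<b a≤a′ b′≤b x-e end = _ , refl , singleton-Spine e x x-e
insert-Spine {x = x} e a<x x<b a≤a′ b′≤b x-e (left {y = y} b≤y s)
  with insert-Spine e a<x x<b a≤a′ b′≤b x-e s
... | t′ , eq , s′ rewrite <ᵇ-true {x} {y} (ℕ.<-≤-trans x<b b≤y) | eq =
  _ , refl , left (ℕ.≤-trans b′≤b b≤y) s′
insert-Spine {x = x} e a<x x<b a≤a′ b′≤b x-e (right {y = y} y≤a s)
  with insert-Spine e a<x x<b a≤a′ b′≤b x-e s
... | t′ , eq , s′ rewrite <ᵇ-false {x} {y} (ℕ.≤-trans y≤a (ℕ.<⇒≤ a<x)) | <ᵇ-true {y} {x} (ℕ.≤-<-trans y≤a a<x) | eq =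
  _ , refl , right (ℕ.≤-trans y≤a a≤a′) s′

-- Effect on the search path d ∷ d′ ∷ v of rotating at its first node: equal
-- directions expel that node from the path, different ones are exchanged.
rotatePath : Dir → Dir → List Dir → List Dir
rotatePath L L v = L ∷ v
rotatePath L R v = R ∷ L ∷ v
rotatePath R L v = L ∷ R ∷ v
rotatePath R R v = R ∷ v

rotateChild-Spine : ∀ {a b t} d d′ v → Spine a b t (d ∷ d′ ∷ v) →
  Spine a b (rotateChild d t) (rotatePath d d′ v)
rotateChild-Spine L L v (left b≤y (left b≤x s))   = left b≤x s
rotateChild-Spine L R v (left b≤y (right x≤a s))  = right x≤a (left b≤y s)
rotateChild-Spine R L v (right y≤a (left b≤x s))  = left b≤x (right y≤a s)
rotateChild-Spine R R v (right y≤a (right x≤a s)) = right x≤a s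

applyAt-Spine : ∀ {a b t} π d d′ v → Spine a b t (π ++ d ∷ d′ ∷ v) →
  Spine a b (applyAt π (rotateChild d) t) (π ++ rotatePath d d′ v)
applyAt-Spine []      d d′ v s             = rotateChild-Spine d d′ v s
applyAt-Spine (L ∷ π) d d′ v (left b≤y s)  = left b≤y (applyAt-Spine π d d′ v s)
applyAt-Spine (R ∷ π) d d′ v (right y≤a s) = right y≤a (applyAt-Spine π d d′ v s)

-- With `ʳ++` a move to the parent is definitional: `(d ∷ rest) ʳ++ v` reduces to `rest ʳ++ d ∷ v`,
-- in step with the recursion of `rebalanceZig`.
rotate-Spine : ∀ {a b t} rest d d′ v → Spine a b t (rest ʳ++ d ∷ d′ ∷ v) →
  Spine a b (applyAt (reverse rest) (rotateChild d) t) (rest ʳ++ rotatePath d d′ v)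
rotate-Spine rest d d′ v s = subst (Spine _ _ _) (sym (ʳ++-defn rest))
  (applyAt-Spine (reverse rest) d d′ v (subst (Spine _ _ _) (ʳ++-defn rest) s))

last-ʳ++ : ∀ {A : Set} (xs : List A) y ys → last (xs ʳ++ y ∷ ys) ≡ last (y ∷ ys)
last-ʳ++ []       y ys = refl
last-ʳ++ (x ∷ xs) y ys = last-ʳ++ xs x (y ∷ ys)

last-rotatePath : ∀ rest d d′ x v → last (rest ʳ++ rotatePath d d′ (x ∷ v)) ≡ last (x ∷ v)
last-rotatePath rest L L x v = last-ʳ++ rest L (x ∷ v)
last-rotatePath rest L R x v = last-ʳ++ rest R (L ∷ x ∷ v)
last-rotatePath rest R L x v = last-ʳ++ rest L (R ∷ x ∷ v)
last-rotatePath rest R R x v = last-ʳ++ rest R (x ∷ v)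

length-rotatePath : ∀ d d′ v → suc (length v) ≤ length (rotatePath d d′ v)
length-rotatePath L L v = ℕ.≤-refl
length-rotatePath L R v = ℕ.n≤1+n _
length-rotatePath R L v = ℕ.n≤1+n _
length-rotatePath R R v = ℕ.≤-refl

-- Depth sum along the search path

depthSum-node : ∀ d m x z → m ℕ.* m ℕ.+ 2 ℕ.* suc d ℕ.* m ≤ 2 ℕ.* x ℕ.+ m →
  suc m ℕ.* suc m ℕ.+ 2 ℕ.* d ℕ.* suc m ≤ 2 ℕ.* (d ℕ.+ x ℕ.+ z) ℕ.+ suc m
depthSum-node d m x z ih = begin
  suc m ℕ.* suc m ℕ.+ 2 ℕ.* d ℕ.* suc m
    ≡⟨ solve 2 (λ m d → (con 1 :+ m) :* (con 1 :+ m) :+ con 2 :* d :* (con 1 :+ m)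
          := m :* m :+ con 2 :* (con 1 :+ d) :* m :+ (con 2 :* d :+ con 1)) refl m d ⟩
  m ℕ.* m ℕ.+ 2 ℕ.* suc d ℕ.* m ℕ.+ (2 ℕ.* d ℕ.+ 1)
    ≤⟨ ℕ.+-monoˡ-≤ _ ih ⟩
  2 ℕ.* x ℕ.+ m ℕ.+ (2 ℕ.* d ℕ.+ 1)
    ≤⟨ ℕ.m≤m+n _ (2 ℕ.* z) ⟩
  2 ℕ.* x ℕ.+ m ℕ.+ (2 ℕ.* d ℕ.+ 1) ℕ.+ 2 ℕ.* z
    ≡⟨ solve 4 (λ x m d z → con 2 :* x :+ m :+ (con 2 :* d :+ con 1) :+ con 2 :* z
          := con 2 :* (d :+ x :+ z) :+ (con 1 :+ m)) refl x m d z ⟩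
  2 ℕ.* (d ℕ.+ x ℕ.+ z) ℕ.+ suc m ∎
  where
  open ℕ.≤-Reasoning
  open ℕ.+-*-Solver

-- The m nodes on the path have depths d, d + 1, ..., d + m - 1, with sum d m + m(m - 1)/2. Doubling
-- and adding m on both sides avoids halves and truncated subtraction.
depthSum-Spine : ∀ {a b t w} d → Spine a b t w →
  length w ℕ.* length w ℕ.+ 2 ℕ.* d ℕ.* length w ≤ 2 ℕ.* depthSum d t ℕ.+ length w
depthSum-Spine d end = ℕ.≤-reflexive (ℕ.*-zeroʳ (2 ℕ.* d))
depthSum-Spine d (left {l} {y} {r} {w} _ s) =
  depthSum-node d (length w) (depthSum (suc d) l) (depthSum (suc d) r) (depthSum-Spine (suc d) s)
depthSum-Spine d (right {l} {y} {r} {w} _ s) =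
  subst (λ x → suc (length w) ℕ.* suc (length w) ℕ.+ 2 ℕ.* d ℕ.* suc (length w) ≤ 2 ℕ.* x ℕ.+ suc (length w)) (swap d (depthSum (suc d) r) (depthSum (suc d) l))
    (depthSum-node d (length w) (depthSum (suc d) r) (depthSum (suc d) l) (depthSum-Spine (suc d) s))
  where
  swap : ∀ d x z → d ℕ.+ x ℕ.+ z ≡ d ℕ.+ z ℕ.+ x
  swap = solve 3 (λ d x z → d :+ x :+ z := d :+ z :+ x) refl
    where open ℕ.+-*-Solver

-- The potential of the search path

opposite : Dir → Dir
opposite L = R
opposite R = L

differs : Dir → Maybe Dir → Bool
-- The empty path counts as ending differently, so a run starts from `φ true 0`.
differs e nothing  = true
differs L (just L) = false
differs L (just R) = true
differs R (just L) = true
differs R (just R) = false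

opposite-differs : ∀ e → differs (opposite e) (just e) ≡ true
opposite-differs L = refl
opposite-differs R = refl

-- The first argument tells whether the path ends in the direction opposite to
-- that of the next key, the third is the number of keys still to be inserted.
Potential : Set
Potential = Bool → ℕ → ℕ → ℚ

record Worth (φ : Potential) (a b : ℕ) (e : Dir) (r : ℕ) (t : Tree) (u : ℚ) : Set where
  constructor worth
  field
    path  : List Dir
    spine : Spine a b t path
    bound : u ≤ℚ φ (differs e (last path)) (length path) r

-- The submartingale condition on `φ` for one insertion. `rev` is the reversed search path before
-- it, whose letters lead to the new leaf; the leaf adds the letter `e`, and the next key comes from
-- the other side.
RebalanceBound : ℚ → Potential → Set
RebalanceBound p φ = ∀ {a b t e w r} rev → 0ℚ ≤ℚ w → Spine a b t (rev ʳ++ [ e ]) →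
  Lower (Worth φ a b (opposite e) r) (rebalanceZig p rev w t)
    (w * φ (differs e (last (reverse rev))) (length rev) (suc r))

insertZig-Worth : ∀ {p φ a b a′ b′ x e r w t u} → RebalanceBound p φ →
  a ℕ.< x → x ℕ.< b → a ≤ a′ → b′ ≤ b → Bounds e x a′ b′ →
  0ℚ ≤ℚ w → Worth φ a b e (suc r) t u →
  Lower (Worth φ a′ b′ (opposite e) r) (insertZig p x w t) (w * u)
insertZig-Worth {φ = φ} {e = e} {r} bound a<x x<b a≤a′ b′≤b x-e 0≤w (worth π s u≤)
  with insert-Spine e a<x x<b a≤a′ b′≤b x-e s
... | t′ , eq , s′ rewrite eq = Lower-weaken
  (*-monoˡ-≤ 0≤w (subst (_ ≤ℚ_) (cong₂ (λ v m → φ (differs e (last v)) m (suc r))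
    (sym (reverse-involutive π)) (sym (length-reverse π))) u≤))
  (bound (reverse π) 0≤w (subst (Spine _ _ t′)
    (sym (trans (ʳ++-defn (reverse π)) (cong (_++ [ e ]) (reverse-involutive π)))) s′))

-- With `k` rounds to go, the open gap from j to j + 2k + 1 holds exactly the 2k missing keys. A
-- round inserts the smallest, `suc j`, which raises the lower end, and then the largest, `n ∸ j`,
-- which lowers the upper end.
convSeq-Worth : ∀ {p φ} → RebalanceBound p φ → ∀ k j {n D v} → n ≡ j ℕ.+ (k ℕ.+ k) ℕ.+ j →
  Lower (Worth φ j (suc (j ℕ.+ (k ℕ.+ k))) R (k ℕ.+ k)) D v →
  Lower (λ t u → Σ ℕ λ a → Σ ℕ λ b → Worth φ a b R 0 t u)
    (foldl (stepDist p) D (convSeqFrom n (suc j) k)) v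
convSeq-Worth bound zero j n≡ ℓ = Lower-map (λ q → _ , _ , q) ℓ
convSeq-Worth {p} {φ} bound (suc k) j {n} n≡ ℓ =
  convSeq-Worth {p} {φ} bound k (suc j) (trans n≡ shift)
    (Lower-step insertLarge (Lower-step insertSmall ℓ))
  where
  open ℕ.+-*-Solver
  shift : j ℕ.+ (suc k ℕ.+ suc k) ℕ.+ j ≡ suc j ℕ.+ (k ℕ.+ k) ℕ.+ suc j
  shift = solve 2 (λ j k → j :+ ((con 1 :+ k) :+ (con 1 :+ k)) :+ j
    := (con 1 :+ j) :+ (k :+ k) :+ (con 1 :+ j)) refl j k
  y≡ : n ℕ.∸ j ≡ suc (suc (j ℕ.+ (k ℕ.+ k)))
  y≡ = trans (cong (ℕ._∸ j) n≡) (trans (ℕ.m+n∸n≡m (j ℕ.+ (suc k ℕ.+ suc k)) j)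
    (solve 2 (λ j k → j :+ ((con 1 :+ k) :+ (con 1 :+ k)) := con 2 :+ (j :+ (k :+ k))) refl j k))
  b≡ : suc (j ℕ.+ (suc k ℕ.+ suc k)) ≡ suc (suc (suc (j ℕ.+ (k ℕ.+ k))))
  b≡ = solve 2 (λ j k → con 1 :+ (j :+ ((con 1 :+ k) :+ (con 1 :+ k))) := con 3 :+ (j :+ (k :+ k))) refl j k
  j<y : suc j ℕ.< n ℕ.∸ j
  j<y rewrite y≡ = ℕ.s≤s (ℕ.s≤s (ℕ.m≤m+n j (k ℕ.+ k)))
  y<b : n ℕ.∸ j ℕ.< suc (j ℕ.+ (suc k ℕ.+ suc k))
  y<b rewrite y≡ | b≡ = ℕ.≤-refl
  b≤ : suc (suc j ℕ.+ (k ℕ.+ k)) ≤ suc (j ℕ.+ (suc k ℕ.+ suc k))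
  b≤ rewrite b≡ = ℕ.n≤1+n _
  y-L : suc (suc j ℕ.+ (k ℕ.+ k)) ≤ n ℕ.∸ j
  y-L rewrite y≡ = ℕ.≤-refl
  x<b : suc j ℕ.< suc (j ℕ.+ (suc k ℕ.+ suc k))
  x<b rewrite b≡ = ℕ.s≤s (ℕ.s≤s (ℕ.≤-trans (ℕ.m≤m+n j (k ℕ.+ k)) (ℕ.n≤1+n _)))
  insertSmall : ∀ {w t u} → 0ℚ ≤ℚ w → Worth φ j (suc (j ℕ.+ (suc k ℕ.+ suc k))) R (suc k ℕ.+ suc k) t u →
    Lower (Worth φ (suc j) (suc (j ℕ.+ (suc k ℕ.+ suc k))) L (suc (k ℕ.+ k))) (insertZig p (suc j) w t) (w * u)
  insertSmall {t = t} {u} 0≤w q =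
    insertZig-Worth {p} {φ} {e = R} bound ℕ.≤-refl x<b (ℕ.n≤1+n j) ℕ.≤-refl ℕ.≤-refl 0≤w
      (subst (λ r → Worth φ j (suc (j ℕ.+ (suc k ℕ.+ suc k))) R r t u) (cong suc (ℕ.+-suc k k)) q)
  insertLarge : ∀ {w t u} → 0ℚ ≤ℚ w → Worth φ (suc j) (suc (j ℕ.+ (suc k ℕ.+ suc k))) L (suc (k ℕ.+ k)) t u →
    Lower (Worth φ (suc j) (suc (suc j ℕ.+ (k ℕ.+ k))) R (k ℕ.+ k)) (insertZig p (n ℕ.∸ j) w t) (w * u)
  insertLarge = insertZig-Worth {p} {φ} {e = L} bound j<y y<b ℕ.≤-refl b≤ y-L

runZig-potential : ∀ {p φ f} → RebalanceBound p φ →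
  (∀ {a b t w c} → Spine a b t w → φ c (length w) 0 ≤ℚ f t) →
  ∀ k → φ true 0 (k ℕ.+ k) ≤ℚ 𝔼 f (runZig p (convSeqFrom (k ℕ.+ k) 1 k))
runZig-potential {p} {φ} bound φ≤f k = subst (_≤ℚ _) (ℚ.*-identityˡ _) (Lower-𝔼
  (λ { (_ , _ , worth _ s u≤) → ℚ.≤-trans u≤ (φ≤f s) })
  (convSeq-Worth {p} {φ} bound k 0 (sym (ℕ.+-identityʳ (k ℕ.+ k)))
    (Lower-point (ℚ.nonNegative⁻¹ 1ℚ) (worth [] end ℚ.≤-refl))))

worth-differs : ∀ {φ a b e r t u} π → Spine a b t π → last π ≡ just e →
  u ≤ℚ φ true (length π) r → Worth φ a b (opposite e) r t u
worth-differs {φ} {e = e} {r} {u = u} π s π-e u≤ = worth π s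
  (subst (λ c → u ≤ℚ φ c (length π) r) (sym (trans (cong (differs (opposite e)) π-e) (opposite-differs e))) u≤)

-- Drift of the potential during one rebalancing

Monotone : Potential → Set
Monotone φ = ∀ {m n r} → m ≤ n → φ true m r ≤ℚ φ true n r

-- Above the last node of the path, the coin flips cost at most one node and
-- leave the end of the path unchanged.
rebalanceZig-tail : ∀ {p φ a b e r} → 0ℚ ≤ℚ p → p ≤ℚ 1ℚ → Monotone φ →
  ∀ m rest d x v {w t} → 0ℚ ≤ℚ w → m ≤ length rest ℕ.+ suc (length v) → last (x ∷ v) ≡ just e →
  Spine a b t (rest ʳ++ d ∷ x ∷ v) →
  Lower (Worth φ a b (opposite e) r) (rebalanceZig p rest w t) (w * φ true m r)
rebalanceZig-tail 0≤p p≤1 mono m [] d x v 0≤w m≤ v-e s =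
  Lower-point 0≤w (worth-differs (d ∷ x ∷ v) s v-e (mono (ℕ.≤-trans m≤ (ℕ.n≤1+n _))))
rebalanceZig-tail 0≤p p≤1 mono m (d′ ∷ rest) d x v 0≤w m≤ v-e s = Lower-branch {d = d′} p≤1 0≤w
  (worth-differs _ (rotate-Spine rest d′ d (x ∷ v) s) (trans (last-rotatePath rest d′ d x v) v-e) (mono m≤′))
  (rebalanceZig-tail 0≤p p≤1 mono m rest d′ d (x ∷ v) (*-nonNeg 0≤w 0≤p)
    (ℕ.≤-trans m≤ (ℕ.≤-reflexive (sym (ℕ.+-suc (length rest) (suc (length v)))))) v-e s)
  where
  -- The bound on `m` leaves one letter to spare, which covers the node expelled when `d′` and `d`
  -- agree.
  m≤′ : m ≤ length (rest ʳ++ rotatePath d′ d (x ∷ v))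
  m≤′ = begin
    m                                                 ≤⟨ m≤ ⟩
    suc (length rest ℕ.+ suc (length v))              ≡⟨ ℕ.+-suc (length rest) (suc (length v)) ⟨
    length rest ℕ.+ suc (suc (length v))              ≤⟨ ℕ.+-monoʳ-≤ (length rest) (length-rotatePath d′ d (x ∷ v)) ⟩
    length rest ℕ.+ length (rotatePath d′ d (x ∷ v))  ≡⟨ length-ʳ++ rest ⟨
    length (rest ʳ++ rotatePath d′ d (x ∷ v))         ∎
    where open ℕ.≤-Reasoning

data Compare (e : Dir) : Dir → Set where
  same  : Compare e e
  other : Compare e (opposite e)

compare : ∀ e d → Compare e d
compare L L = same
compare L R = other
compare R L = other
compare R R = same

differs-same : ∀ e → differs e (just e) ≡ false
differs-same L = refl
differs-same R = refl

differs-opposite : ∀ e → differs e (just (opposite e)) ≡ true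
differs-opposite L = refl
differs-opposite R = refl

rotatePath-same : ∀ e v → rotatePath e e v ≡ e ∷ v
rotatePath-same L v = refl
rotatePath-same R v = refl

rotatePath-opposite : ∀ e v → rotatePath (opposite e) e v ≡ e ∷ opposite e ∷ v
rotatePath-opposite L v = refl
rotatePath-opposite R v = refl

-- The last three premises treat the empty path, a last letter `e` and a last letter opposite to
-- `e`. In the second case head and tail alike leave at least m letters, the last being `e`. In the
-- third a head swaps the last two of m + 1 letters, whence `false (suc m)`, while a tail keeps `e`
-- last and at least m letters.
rebalanceBound : ∀ {p} φ → 0ℚ ≤ℚ p → p ≤ℚ 1ℚ → Monotone φ →
  (∀ r → φ true 0 (suc r) ≤ℚ φ true 1 r) →
  (∀ m r → φ false m (suc r) ≤ℚ φ true m r) →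
  (∀ m r → φ true m (suc r) ≤ℚ (1ℚ - p) * φ false (suc m) r + p * φ true m r) →
  RebalanceBound p φ
rebalanceBound φ 0≤p p≤1 mono empty same≤ other≤ {e = e} {r = r} [] 0≤w s =
  Lower-weaken (*-monoˡ-≤ 0≤w (empty r)) (Lower-point 0≤w (worth-differs [ e ] s refl ℚ.≤-refl))
rebalanceBound {p} φ 0≤p p≤1 mono empty same≤ other≤ {a} {b} {t} {e} {w} {r} (d ∷ rest) 0≤w s
  rewrite last-ʳ++ rest d [] with compare e d
... | same rewrite differs-same e =
  Lower-weaken (*-monoˡ-≤ 0≤w (same≤ m r)) (Lower-branch {d = e} p≤1 0≤w
    (worth-differs (rest ʳ++ [ e ])
      (subst (Spine a b _) (cong (rest ʳ++_) (rotatePath-same e [])) (rotate-Spine rest e e [] s))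
      (last-ʳ++ rest e []) (mono (ℕ.≤-reflexive (trans (ℕ.+-comm 1 (length rest)) (sym (length-ʳ++ rest))))))
    (rebalanceZig-tail 0≤p p≤1 mono m rest e e [] (*-nonNeg 0≤w 0≤p) (ℕ.≤-reflexive (ℕ.+-comm 1 (length rest))) refl s))
  where m = suc (length rest)
... | other rewrite differs-opposite e =
  cons (*-nonNeg 0≤w (difference-nonNeg p≤1)) rotated
    (ℚ.≤-trans (*-monoˡ-≤ 0≤w (other≤ m r)) (ℚ.≤-reflexive
      (solve 4 (λ w p x y → w :* ((con 1ℚ :- p) :* x :+ p :* y) := w :* (con 1ℚ :- p) :* x :+ w :* p :* y)
        refl w p (φ false (suc m) r) (φ true m r))))
    (rebalanceZig-tail 0≤p p≤1 mono m rest (opposite e) e [] (*-nonNeg 0≤w 0≤p)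
      (ℕ.≤-reflexive (ℕ.+-comm 1 (length rest))) refl s)
  where
  open +-*-Solver
  m = suc (length rest)
  π = rest ʳ++ e ∷ opposite e ∷ []
  rotated : Worth φ a b (opposite e) r (applyAt (reverse rest) (rotateChild (opposite e)) t) (φ false (suc m) r)
  rotated = worth π
    (subst (Spine a b _) (cong (rest ʳ++_) (rotatePath-opposite e [])) (rotate-Spine rest (opposite e) e [] s))
    (ℚ.≤-reflexive (sym (cong₂ (λ c k → φ c k r)
      (trans (cong (differs (opposite e)) (last-ʳ++ rest e [ opposite e ])) (differs-same (opposite e)))
      (trans (length-ʳ++ rest) (ℕ.+-comm (length rest) 2)))))

rebalanceZig-1 : ∀ {φ a b e r w t u} → 0ℚ ≤ℚ w → Worth φ a b e r t u →
  ∀ rev d v → Spine a b t (rev ʳ++ d ∷ v) → Lower (Worth φ a b e r) (rebalanceZig 1ℚ rev w t) (w * u)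
rebalanceZig-1 0≤w q [] d v s = Lower-point 0≤w q
rebalanceZig-1 {w = w} {u = u} 0≤w q (d′ ∷ rev) d v s =
  -- `Lower` asks for a worth even on this branch of weight zero; the potential of the rotated
  -- tree's own path will do.
  cons (subst (0ℚ ≤ℚ_) (sym (ℚ.*-zeroʳ w)) ℚ.≤-refl) (worth _ (rotate-Spine rev d′ d v s) ℚ.≤-refl)
    (ℚ.≤-reflexive (solve 3 (λ w u x → w :* u := w :* con 0ℚ :* x :+ w :* con 1ℚ :* u) refl w u _))
    (rebalanceZig-1 (*-nonNeg 0≤w (ℚ.nonNegative⁻¹ 1ℚ)) q rev d′ (d ∷ v) s)
  where open +-*-Solver

rebalanceBound-1 : ∀ φ → (∀ c c′ m r → φ c m (suc r) ≤ℚ φ c′ (suc m) r) → RebalanceBound 1ℚ φ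
rebalanceBound-1 φ φ≤ {e = e} {r = r} rev 0≤w s =
  rebalanceZig-1 0≤w (worth (rev ʳ++ [ e ]) s
    (ℚ.≤-trans (φ≤ _ _ _ r) (ℚ.≤-reflexive (cong (λ k → φ (differs (opposite e) (last (rev ʳ++ [ e ]))) k r)
      (sym (trans (length-ʳ++ rev) (ℕ.+-comm (length rev) 1))))))) rev e [] s

-- The lower bound

-- The search path gains at least g nodes per insertion in expectation, phrased
-- through affine minorants so that no path function on trees is needed.
PathGrowth : ℚ → ℚ → Set
PathGrowth p g = ∀ κ δ f → 0ℚ ≤ℚ κ →
  (∀ {a b t w} → Spine a b t w → κ * ℕtoℚ (length w) - δ ≤ℚ f t) →
  ∀ k → κ * (g * ℕtoℚ (k ℕ.+ k)) - δ ≤ℚ 𝔼 f (runZig p (convSeqFrom (k ℕ.+ k) 1 k))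

-- The term `g * ℕtoℚ r` credits each key still to come with a gain of g, so that growth at rate g
-- amounts to a potential that does not fall in expectation.
linear : ℚ → ℚ → ℚ → Potential
linear κ δ g true  m r = κ * (ℕtoℚ m + g * ℕtoℚ r) - δ
linear κ δ g false m r = κ * (ℕtoℚ m + g * ℕtoℚ r - g) - δ

pathGrowth-1 : PathGrowth 1ℚ 1ℚ
pathGrowth-1 κ δ f 0≤κ κ≤f k = subst (_≤ℚ _)
  (solve 3 (λ κ δ x → κ :* (con 0ℚ :+ con 1ℚ :* x) :- δ := κ :* (con 1ℚ :* x) :- δ) refl κ δ (ℕtoℚ (k ℕ.+ k)))
  (runZig-potential {1ℚ} {φ} (rebalanceBound-1 φ step) (λ {a} {b} {t} {w} {c} → final {c = c}) k)
  where
  open +-*-Solver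
  φ : Potential
  φ _ = linear κ δ 1ℚ true
  step : ∀ c c′ m r → φ c m (suc r) ≤ℚ φ c′ (suc m) r
  step _ _ m r rewrite ℕtoℚ-suc m | ℕtoℚ-suc r = ℚ.≤-reflexive (solve 4
    (λ κ δ m r → κ :* (m :+ con 1ℚ :* (con 1ℚ :+ r)) :- δ := κ :* (con 1ℚ :+ m :+ con 1ℚ :* r) :- δ)
    refl κ δ (ℕtoℚ m) (ℕtoℚ r))
  final : ∀ {a b t w} {c : Bool} → Spine a b t w → φ c (length w) 0 ≤ℚ f t
  final {w = w} s = ℚ.≤-trans (ℚ.≤-reflexive (solve 3
    (λ κ δ m → κ :* (m :+ con 1ℚ :* con 0ℚ) :- δ := κ :* m :- δ) refl κ δ (ℕtoℚ (length w)))) (κ≤f s)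

-- The rate g = (1 - p)/2 solves the two drift inequalities g ≤ g (the path
-- ends like the new key) and g ≤ (1 - p)(1 - g) (it does not).
pathGrowth-<1 : ∀ {p} → 0ℚ ≤ℚ p → p ≤ℚ 1ℚ → PathGrowth p (½ * (1ℚ - p))
pathGrowth-<1 {p} 0≤p p≤1 κ δ f 0≤κ κ≤f k = subst (_≤ℚ _)
  (solve 4 (λ κ δ g x → κ :* (con 0ℚ :+ g :* x) :- δ := κ :* (g :* x) :- δ) refl κ δ g (ℕtoℚ (k ℕ.+ k)))
  (runZig-potential {p} {φ} (rebalanceBound φ 0≤p p≤1 (λ {m} {n} {r} → mono {m} {n} {r}) empty same≤ other≤)
    (λ {a} {b} {t} {w} {c} → final {c = c}) k)
  where
  open +-*-Solver
  g = ½ * (1ℚ - p)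
  φ = linear κ δ g
  0≤½ : 0ℚ ≤ℚ ½
  0≤½ = ℚ.nonNegative⁻¹ ½
  0≤g : 0ℚ ≤ℚ g
  0≤g = *-nonNeg 0≤½ (difference-nonNeg p≤1)
  mono : Monotone φ
  mono {m} {n} {r} m≤n = ℚ.+-monoˡ-≤ (- δ) (*-monoˡ-≤ 0≤κ (ℚ.+-monoˡ-≤ (g * ℕtoℚ r) (ℕtoℚ-mono m≤n)))
  empty : ∀ r → φ true 0 (suc r) ≤ℚ φ true 1 r
  -- The surplus is κ(1 - g): the first letter gains 1 where only g is due.
  empty r rewrite ℕtoℚ-suc r = ≤-fromDifference (κ * (½ + ½ * p))
    (*-nonNeg 0≤κ (+-nonNeg 0≤½ (*-nonNeg 0≤½ 0≤p)))
    (solve 4 (λ κ δ p r →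
      κ :* (con 1ℚ :+ con ½ :* (con 1ℚ :- p) :* r) :- δ
      := κ :* (con 0ℚ :+ con ½ :* (con 1ℚ :- p) :* (con 1ℚ :+ r)) :- δ :+ κ :* (con ½ :+ con ½ :* p))
      refl κ δ p (ℕtoℚ r))
  same≤ : ∀ m r → φ false m (suc r) ≤ℚ φ true m r
  same≤ m r rewrite ℕtoℚ-suc r = ℚ.≤-reflexive (solve 5
    (λ κ δ g m r → κ :* (m :+ g :* (con 1ℚ :+ r) :- g) :- δ := κ :* (m :+ g :* r) :- δ)
    refl κ δ g (ℕtoℚ m) (ℕtoℚ r))
  other≤ : ∀ m r → φ true m (suc r) ≤ℚ (1ℚ - p) * φ false (suc m) r + p * φ true m r
  -- Since 1 - p = 2g, the surplus (1 - p)(1 - g) - g equals g(1 - 2g) = g p.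
  other≤ m r rewrite ℕtoℚ-suc m | ℕtoℚ-suc r = ≤-fromDifference (κ * (g * p))
    (*-nonNeg 0≤κ (*-nonNeg 0≤g 0≤p))
    (solve 5 (λ κ δ p m r → let g = con ½ :* (con 1ℚ :- p) in
      (con 1ℚ :- p) :* (κ :* (con 1ℚ :+ m :+ g :* r :- g) :- δ) :+ p :* (κ :* (m :+ g :* r) :- δ)
      := κ :* (m :+ g :* (con 1ℚ :+ r)) :- δ :+ κ :* (g :* p))
      refl κ δ p (ℕtoℚ m) (ℕtoℚ r))
  final : ∀ {a b t w c} → Spine a b t w → φ c (length w) 0 ≤ℚ f t
  final {w = w} {true} s = ℚ.≤-trans (ℚ.≤-reflexive (solve 4
    (λ κ δ g m → κ :* (m :+ g :* con 0ℚ) :- δ := κ :* m :- δ) refl κ δ g (ℕtoℚ (length w)))) (κ≤f s)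
  final {w = w} {false} s = ℚ.≤-trans (≤-fromDifference (κ * g) (*-nonNeg 0≤κ 0≤g) (solve 4
    (λ κ δ g m → κ :* m :- δ := κ :* (m :+ g :* con 0ℚ :- g) :- δ :+ κ :* g) refl κ δ g (ℕtoℚ (length w)))) (κ≤f s)

-- The case split is due to the rate (1 - p)/2, which vanishes at p = 1.
pathGrowth : ∀ p → 0ℚ ≤ℚ p → p ≤ℚ 1ℚ → Σ ℚ λ g → (0ℚ < g) × PathGrowth p g
pathGrowth p 0≤p p≤1 with p ℚ.≟ 1ℚ
... | yes refl = 1ℚ , ℚ.positive⁻¹ 1ℚ , pathGrowth-1
... | no  p≢1  = ½ * (1ℚ - p) , 0<g , pathGrowth-<1 0≤p p≤1
  where
  p<1 : p < 1ℚ
  p<1 = ℚ.≰⇒> (λ 1≤p → p≢1 (ℚ.≤-antisym p≤1 1≤p))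
  0<g : 0ℚ < ½ * (1ℚ - p)
  0<g = subst (_< ½ * (1ℚ - p)) (trans (cong (½ *_) (ℚ.+-inverseʳ p)) (ℚ.*-zeroʳ ½))
    (ℚ.*-monoʳ-<-pos ½ (ℚ.+-monoˡ-< (- p) p<1))

-- A path of m nodes has depth sum at least m(m - 1)/2, and
-- 2m(m - 1) + 1 = m² + (m - 1)² ≥ m² ≥ 2 A m - A²: the tangent at A.
depthSum-tangent : ∀ A {a b t w} → Spine a b t w →
  (A + A) * ℕtoℚ (length w) - (A * A + 1ℚ) ≤ℚ ℕtoℚ 4 * ℕtoℚ (depthSum 0 t)
depthSum-tangent A {t = t} {w} s = ≤-fromDifference
  -- `z` is the slack in `depthSum-Spine 0 s`; the squares are the error of the tangent at A and the
  -- term (m - 1)².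
  ((z + z) + ((m - A) * (m - A) + (m - 1ℚ) * (m - 1ℚ)))
  (+-nonNeg (+-nonNeg 0≤z 0≤z) (+-nonNeg (square-nonNeg (m - A)) (square-nonNeg (m - 1ℚ))))
  (solve 3 (λ A m x → let z = con (ℕtoℚ 2) :* x :+ m :- m :* m in
    con (ℕtoℚ 4) :* x := (A :+ A) :* m :- (A :* A :+ con 1ℚ)
      :+ ((z :+ z) :+ ((m :- A) :* (m :- A) :+ (m :- con 1ℚ) :* (m :- con 1ℚ)))) refl A m x)
  where
  open +-*-Solver
  m = ℕtoℚ (length w)
  x = ℕtoℚ (depthSum 0 t)
  z = ℕtoℚ 2 * x + m - m * m
  0≤z : 0ℚ ≤ℚ z
  0≤z = difference-nonNeg (begin
    m * m                                        ≡⟨ ℕtoℚ-homo-* (length w) (length w) ⟨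
    ℕtoℚ (length w ℕ.* length w)                 ≤⟨ ℕtoℚ-mono (ℕ.≤-trans (ℕ.m≤m+n (length w ℕ.* length w) 0) (depthSum-Spine 0 s)) ⟩
    ℕtoℚ (2 ℕ.* depthSum 0 t ℕ.+ length w)       ≡⟨ ℕtoℚ-homo-+ (2 ℕ.* depthSum 0 t) (length w) ⟩
    ℕtoℚ (2 ℕ.* depthSum 0 t) + m                ≡⟨ cong (_+ m) (ℕtoℚ-homo-* 2 (depthSum 0 t)) ⟩
    ℕtoℚ 2 * x + m                               ∎)
    where open ≤-Reasoning

⅛ : ℚ
⅛ = (+ 1) ℚ./ 8

-- The tangent is taken at A = g n, the lower bound on the expected path length. This gives 4 n e ≥
-- 2A² - (A² + 1) = A² - 1, and A ≥ 2 makes the right side at least A²/2.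
avgDepth-lower : ∀ {p g} → PathGrowth p g → ∀ n {k} → suc n ≡ k ℕ.+ k →
  ℕtoℚ 2 ≤ℚ g * ℕtoℚ (suc n) →
  ⅛ * (g * g) * ℕtoℚ (suc n) ≤ℚ expAvgDepth (suc n) (runZig p (convSeqFrom (suc n) 1 k))
avgDepth-lower {p} {g} growth n {k} n≡2k 2≤A = ℚ.*-cancelˡ-≤-pos N {{positive 0<N}}
  -- The remainder (A² - 2)/8 is expanded around A = 2, where every term is visibly nonnegative.
  (≤-fromDifference (½ * ½ * z + ⅛ * ((A - two) * (A - two) + ℕtoℚ 4 * (A - two) + two))
    (+-nonNeg (*-nonNeg (ℚ.nonNegative⁻¹ (½ * ½)) (difference-nonNeg bound))
      (*-nonNeg (ℚ.nonNegative⁻¹ ⅛) (+-nonNeg (+-nonNeg (square-nonNeg (A - two))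
        (*-nonNeg (ℕtoℚ-nonNeg 4) (difference-nonNeg 2≤A))) (ℕtoℚ-nonNeg 2))))
    (solve 3 (λ g N e → let A = g :* N in let two = con (ℕtoℚ 2) in
       N :* e := N :* (con ⅛ :* (g :* g) :* N) :+ (con (½ * ½) :* (con (ℕtoℚ 4) :* (N :* e) :- ((A :+ A) :* A :- (A :* A :+ con 1ℚ)))
         :+ con ⅛ :* ((A :- two) :* (A :- two) :+ con (ℕtoℚ 4) :* (A :- two) :+ two))) refl g N e))
  where
  open +-*-Solver
  N = ℕtoℚ (suc n)
  A = g * N
  D = runZig p (convSeqFrom (suc n) 1 k)
  e = expAvgDepth (suc n) D
  two = ℕtoℚ 2
  z = ℕtoℚ 4 * (N * e) - ((A + A) * A - (A * A + 1ℚ))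

  0<N : 0ℚ < N
  0<N = ℚ.<-≤-trans (ℚ.positive⁻¹ 1ℚ) (ℕtoℚ-mono {1} {suc n} (ℕ.s≤s ℕ.z≤n))

  0≤A : 0ℚ ≤ℚ A
  0≤A = ℚ.≤-trans (ℕtoℚ-nonNeg 2) 2≤A

  bound : (A + A) * A - (A * A + 1ℚ) ≤ℚ ℕtoℚ 4 * (N * e)
  bound = subst ((A + A) * A - (A * A + 1ℚ) ≤ℚ_) (𝔼-depthSum (ℕtoℚ 4) n D)
    (subst (λ j → (A + A) * (g * ℕtoℚ j) - (A * A + 1ℚ) ≤ℚ
                  𝔼 (λ t → ℕtoℚ 4 * ℕtoℚ (depthSum 0 t)) (runZig p (convSeqFrom j 1 k))) (sym n≡2k)
      (growth (A + A) (A * A + 1ℚ) (λ t → ℕtoℚ 4 * ℕtoℚ (depthSum 0 t)) (+-nonNeg 0≤A 0≤A) (depthSum-tangent A) k))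

theorem3 : (p : ℚ) → 0ℚ ≤ℚ p → p ≤ℚ 1ℚ →
    Σ ℚ (λ c₁ → Σ ℚ (λ c₂ → Σ ℕ (λ N →
    (0ℚ < c₁) × (0ℚ < c₂) ×
    ((n : ℕ) → 2 ∣ n → N ≤ n →
    (c₁ * ℕtoℚ n ≤ℚ E p n) × (E p n ≤ℚ c₂ * ℕtoℚ n)))))
theorem3 p 0≤p p≤1 with pathGrowth p 0≤p p≤1
... | g , 0<g , growth with archimedean g 0<g
-- As N g ≥ 1, the threshold 2N ensures the g n ≥ 2 that `avgDepth-lower` requires.
... | N , 0<N , 1≤Ng = ⅛ * (g * g) , 1ℚ , N ℕ.+ N , 0<c₁ , ℚ.positive⁻¹ 1ℚ , bounds
  where
  0<c₁ : 0ℚ < ⅛ * (g * g)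
  0<c₁ = ℚ.positive⁻¹ _ {{ℚ.pos*pos⇒pos ⅛ (g * g) {{ℚ.pos*pos⇒pos g {{positive 0<g}} g {{positive 0<g}}}}}}

  2≤gn : ∀ {n} → N ℕ.+ N ≤ n → ℕtoℚ 2 ≤ℚ g * ℕtoℚ n
  2≤gn {n} 2N≤n = begin
    ℕtoℚ 2                    ≤⟨ ℚ.+-mono-≤ 1≤Ng 1≤Ng ⟩
    ℕtoℚ N * g + ℕtoℚ N * g   ≡⟨ ℚ.*-distribʳ-+ g (ℕtoℚ N) (ℕtoℚ N) ⟨
    (ℕtoℚ N + ℕtoℚ N) * g     ≡⟨ cong (_* g) (ℕtoℚ-homo-+ N N) ⟨
    ℕtoℚ (N ℕ.+ N) * g        ≤⟨ *-monoʳ-≤ (ℚ.<⇒≤ 0<g) (ℕtoℚ-mono 2N≤n) ⟩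
    ℕtoℚ n * g                ≡⟨ ℚ.*-comm (ℕtoℚ n) g ⟩
    g * ℕtoℚ n                ∎
    where open ≤-Reasoning

  bounds : (n : ℕ) → 2 ∣ n → N ℕ.+ N ≤ n →
    (⅛ * (g * g) * ℕtoℚ n ≤ℚ E p n) × (E p n ≤ℚ 1ℚ * ℕtoℚ n)
  bounds zero    _ 2N≤0 = contradiction (ℕ.≤-trans 0<N (ℕ.≤-trans (ℕ.m≤m+n N N) 2N≤0)) λ ()
  -- The rewriting turns the number of rounds in `convSeq`, half of `suc n`, into the quotient `k`.
  bounds (suc n) (divides k n≡k*2) 2N≤n rewrite trans (cong (ℕ._/ 2) n≡k*2) (m*n/n≡m k 2) =
    avgDepth-lower {g = g} growth n {k} n≡2k (2≤gn 2N≤n) ,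
    ℚ.≤-trans (avgDepth-upper 0≤p p≤1 n {k} n≡2k) (ℚ.≤-reflexive (sym (ℚ.*-identityˡ (ℕtoℚ (suc n)))))
    where
    n≡2k : suc n ≡ k ℕ.+ k
    n≡2k = trans n≡k*2 (trans (ℕ.*-comm k 2) (cong (k ℕ.+_) (ℕ.+-identityʳ k)))
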